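{- Let $\nu$ be a lattice path from $(0,0)$ to $(b,a)$. The map $\varphi:\mathcal{T}_\nu\rightarrow\mathcal{P}_\nu$ is a bijection between the set $\mathcal{T}_\nu$ of $\nu$-Schröder trees and the set $\mathcal{P}_\nu$ of $\nu$-Schröder paths.
   Context: A lattice path from $(0,0)$ to $(b,a)\in\mathbb{Z}_{\ge0}^2$ is a sequence of $a$ north steps $N=(0,1)$ and $b$ east steps $E=(1,0)$. A $\nu$-Schröder path is a path from $(0,0)$ to $(b,a)$ with steps $N$, $E$, $D=(1,1)$ which stays weakly above $\nu$. $R_\nu$ is the region weakly above $\nu$ inside the rectangle with corners $(0,0)$ and $(b,a)$. Two lattice points $p,q$ in $R_\nu$ are $\nu$-incompatible if $p$ is strictly southwest or strictly northeast of $q$ (both coordinates differ) and the smallest rectangle containing $p$ and $q$ is contained in $R_\nu$; otherwise they are $\nu$-compatible. A $\nu$-Schröder tree is a set $T$ of pairwise $\nu$-compatible lattice points in $R_\nu$ which includes the point $(0,a)$ (the root) and such that each of the $a+1$ rows and each of the $b+1$ columns of the grid contains at least one point of $T$. Labels: each non-root point $p$ of $T$ receives the label $N$ if $T$ has a point above $p$ in the same column, $E$ if $T$ has a point to the left of $p$ in the same row, and $D$ if neither holds ($\nu$-compatibility guarantees that the first two cases do not both occur). (Equivalently, in the plane tree associated with $T$, the label records whether the parent of $p$ lies in the same column, the same row, or neither.) The map $\varphi$: list the non-root points of $T$ row by row from bottom to top and within each row from right to left (equivalently, in counterclockwise post-order of the tree). Then $\varphi(T)$ is the path starting at $(0,0)$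 whose sequence of steps is the sequence of labels in this order. -}

module Defs where

open import Data.Bool using (if_then_else_)
open import Data.Fin using (Fin; zero; toℕ; fromℕ; _<_; _≤_)
import Data.Fin.Properties as Fin
import Data.Fin.Subset as Subset
import Data.Fin.Subset.Properties as Subset
open import Data.List using (List; []; _∷_; allFin; cartesianProductWith; filter; foldl; map; reverse)
open import Data.List.Membership.Propositional using () renaming (_∈_ to _∈ˡ_)
open import Data.List.Relation.Binary.Pointwise using (Pointwise)
open import Data.List.Relation.Unary.All using (All)
import Data.Nat as ℕ
open import Data.Nat using (ℕ; suc)
open import Data.Product using (Σ; _×_; _,_; proj₁; proj₂; ∃)
import Data.Product.Properties as Product
open import Data.Sum using (_⊎_)
open import Data.Vec using (Vec; lookup)
open import Function using (_on_)
open import Relation.Binary.PropositionalEquality using (_≡_; _≢_)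
open import Relation.Nullary using (¬_; Dec)
open import Relation.Nullary.Decidable using (¬?; _×-dec_; does)

-- Points are written (x , y), x being the column and y the row.

data Step : Set where
  N E D : Step

move : ℕ × ℕ → Step → ℕ × ℕ
move (x , y) N = x     , suc y
move (x , y) E = suc x , y
move (x , y) D = suc x , suc y

vertices : ℕ × ℕ → List Step → List (ℕ × ℕ)
vertices p []      = p ∷ []
vertices p (s ∷ w) = p ∷ vertices (move p s) w

EndsAt : ℕ × ℕ → List Step → Set
EndsAt p w = foldl move (0 , 0) w ≡ p

LatticePath : ℕ → ℕ → Set
LatticePath b a = Σ (List Step) λ w → All (_≢ D) w × EndsAt (b , a) w

-- Over each strip i ≤ x ≤ i + 1 a path is a single segment (an E or a D step).
-- `segments h w` lists, for a path starting at height h, the heights of the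
-- left and right ends of these segments, from left to right.
segments : ℕ → List Step → List (ℕ × ℕ)
segments h []      = []
segments h (N ∷ w) = segments (suc h) w
segments h (E ∷ w) = (h , h) ∷ segments h w
segments h (D ∷ w) = (h , suc h) ∷ segments (suc h) w

-- `StaysAbove ν w`: as plane curves from (0,0) to a common end point, w is
-- weakly above ν.  It is not enough to look at the vertices of w: a D step
-- joining two vertices of ν can cut below a corner NE of ν.  N steps need no
-- condition of their own, since w is connected and starts where ν does.
StaysAbove : List Step → List Step → Set
StaysAbove ν w =
  Pointwise (λ (l , r) (l′ , r′) → l ℕ.≤ l′ × r ℕ.≤ r′) (segments 0 ν) (segments 0 w)

module _ {b a : ℕ} where

  IsSchröderPath : LatticePath b a → List Step → Set
  IsSchröderPath (ν , _) w = EndsAt (b , a) w × StaysAbove ν w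

  SchröderPath : LatticePath b a → Set
  SchröderPath ν = ∃ (IsSchröderPath ν)

-- The lattice points of the rectangle with corners (0,0) and (b,a).
GridPoint : ℕ → ℕ → Set
GridPoint b a = Fin (suc b) × Fin (suc a)

-- Sets of such points, given by the subset of columns occupied in each row
-- (rows listed from bottom to top), so that _≡_ is equality of sets.
PointSet : ℕ → ℕ → Set
PointSet b a = Vec (Subset.Subset (suc b)) (suc a)

module _ {b a : ℕ} where

  infix 4 _∈_ _∈?_ _≪_ _∈R_

  _∈_ : GridPoint b a → PointSet b a → Set
  (x , y) ∈ T = x Subset.∈ lookup T y

  _∈?_ : (p : GridPoint b a) (T : PointSet b a) → Dec (p ∈ T)
  (x , y) ∈? T = x Subset.∈? lookup T y

  root : GridPoint b a
  root = zero , fromℕ a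

  -- p lies in R_ν: some point of ν is in the column of p, at or below p.
  _∈R_ : GridPoint b a → LatticePath b a → Set
  (x , y) ∈R (ν , _) = ∃ λ h → (toℕ x , h) ∈ˡ vertices (0 , 0) ν × h ℕ.≤ toℕ y

  -- p is strictly southwest of q.
  _≪_ : GridPoint b a → GridPoint b a → Set
  (x , y) ≪ (x′ , y′) = x < x′ × y < y′

  -- r lies in the rectangle with southwest corner p and northeast corner q.
  InRectangle : (p q r : GridPoint b a) → Set
  InRectangle (x , y) (x′ , y′) (u , v) = (x ≤ u × u ≤ x′) × (y ≤ v × v ≤ y′)

  Incompatible : LatticePath b a → GridPoint b a → GridPoint b a → Set
  Incompatible ν p q =
      (p ≪ q × (∀ r → InRectangle p q r → r ∈R ν))
    ⊎ (q ≪ p × (∀ r → InRectangle q p r → r ∈R ν))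

  record IsSchröderTree (ν : LatticePath b a) (T : PointSet b a) : Set where
    field
      inRegion   : ∀ {p} → p ∈ T → p ∈R ν
      compatible : ∀ {p q} → p ∈ T → q ∈ T → ¬ Incompatible ν p q
      hasRoot    : root ∈ T
      rows       : ∀ y → ∃ λ x → (x , y) ∈ T
      columns    : ∀ x → ∃ λ y → (x , y) ∈ T

  SchröderTree : LatticePath b a → Set
  SchröderTree ν = ∃ (IsSchröderTree ν)

  pointAbove? : (T : PointSet b a) ((x , y) : GridPoint b a) →
                Dec (∃ λ y′ → y < y′ × (x , y′) ∈ T)
  pointAbove? T (x , y) = Fin.any? λ y′ → (y Fin.<? y′) ×-dec ((x , y′) ∈? T)

  pointLeft? : (T : PointSet b a) ((x , y) : GridPoint b a) →
               Dec (∃ λ x′ → x′ < x × (x′ , y) ∈ T)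
  pointLeft? T (x , y) = Fin.any? λ x′ → (x′ Fin.<? x) ×-dec ((x′ , y) ∈? T)

  -- In a ν-Schröder tree the first two cases exclude each other, so the order
  -- of the tests is immaterial there.
  label : PointSet b a → GridPoint b a → Step
  label T p = if does (pointAbove? T p) then N
              else if does (pointLeft? T p) then E
              else D

  _≟_ : (p q : GridPoint b a) → Dec (p ≡ q)
  _≟_ = Product.≡-dec Fin._≟_ Fin._≟_

  -- Rows from bottom to top, each row from right to left.
  readingOrder : List (GridPoint b a)
  readingOrder =
    cartesianProductWith (λ y x → x , y) (allFin (suc a)) (reverse (allFin (suc b)))

  nonRootPoints : PointSet b a → List (GridPoint b a)
  nonRootPoints T = filter (λ p → (p ∈? T) ×-dec ¬? (p ≟ root)) readingOrder

  φ : PointSet b a → List Step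
  φ T = map (label T) (nonRootPoints T)

  -- Trees are compared as sets of points and paths as words, ignoring the
  -- proofs that these are ν-Schröder.
  _≈ᵀ_ : {ν : LatticePath b a} → SchröderTree ν → SchröderTree ν → Set
  _≈ᵀ_ = _≡_ on proj₁

  _≈ᴾ_ : {ν : LatticePath b a} → SchröderPath ν → SchröderPath ν → Set
  _≈ᴾ_ = _≡_ on proj₁

  restrictφ : (ν : LatticePath b a) →
              (∀ T → IsSchröderTree ν T → IsSchröderPath ν (φ T)) →
              SchröderTree ν → SchröderPath ν
  restrictφ ν φ-path (T , t) = φ T , φ-path T t

{-# OPTIONS --safe #-}

-- Remove the rows of a tree T from the bottom.  Let r be the last column met by
-- the bottom row of the region, and m the column of the leftmost point of T in
-- that row.  By compatibility no column in (m, r] has a point of T higher up, so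
-- every one of them has its point in the bottom row, which is thus the interval
-- [m, r].  Its points right of m are labelled E and end their columns; the point
-- at m is labelled N if its column goes on and D if it ends there as well.
-- Deleting the row and the ended columns leaves a smaller tree of the same kind.
-- So T is recorded by a stack of surviving columns: an E step of ν pushes a
-- column, an E or D step of the word pops one, and the word is a path above ν
-- exactly when the stack always keeps the column of the root.

module Submission where

open import Defs
open import Data.Nat using (ℕ)
open import Data.Product using (Σ)
open import Function.Definitions using (Bijective)

open import Data.Bool using (if_then_else_)
open import Data.Empty using (⊥-elim)
open import Data.Fin as Fin using (Fin; zero; suc; toℕ; fromℕ; fromℕ<)
import Data.Fin.Properties as Fin
open import Data.Fin.Subset using (Subset) renaming (_∈_ to _∈ˢ_)
import Data.Fin.Subset.Properties as Subset
open import Data.List using (List; []; _∷_; _++_; [_]; allFin; cartesianProductWith; filter; foldl; length; map;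
  replicate; reverse; tabulate)
open import Data.List.Membership.Propositional using () renaming (_∈_ to _∈ˡ_)
open import Data.List.Membership.Propositional.Properties using
  (∈-++⁺ˡ; ∈-++⁺ʳ; ∈-++⁻; ∈-insert; ∈-filter⁺; ∈-filter⁻; ∈-allFin)
import Data.List.Properties as List
open import Data.List.Relation.Binary.Pointwise using (Pointwise; []; _∷_; Pointwise-length)
open import Data.List.Relation.Unary.All as All using (All; []; _∷_)
import Data.List.Relation.Unary.All.Properties as All
open import Data.List.Relation.Unary.AllPairs as AllPairs using (AllPairs; []; _∷_)
import Data.List.Relation.Unary.AllPairs.Properties as AllPairs
open import Data.List.Relation.Unary.Any using (here; there)
open import Data.List.Relation.Unary.Any.Properties using (reverse⁺; reverse⁻)
open import Data.Nat using (zero; suc; _+_; _≤_; _<_; z≤n; s≤s; s≤s⁻¹)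
import Data.Nat.Properties as ℕ
open import Data.Product using (_×_; _,_; proj₁; proj₂; ∃)
open import Data.Sum as Sum using (_⊎_; inj₁; inj₂)
open import Data.Vec as Vec using (Vec; []; _∷_; lookup)
import Data.Vec.Properties as Vec
open import Function using (_∘_)
open import Relation.Binary using (tri<; tri≈; tri>)
open import Relation.Binary.PropositionalEquality using
  (_≡_; _≢_; refl; sym; trans; cong; cong₂; subst; subst₂; module ≡-Reasoning)
open import Relation.Nullary using (¬_; yes; no; does)
open import Relation.Nullary.Decidable using (_×-dec_; ¬?; dec-true; dec-false)
open import Relation.Unary using (Decidable)

-- Decreasing lists of columns and the subsets that they represent

Falling : ∀ {n} → List (Fin n) → Set
Falling = AllPairs Fin._>_

falling-++ʳ : ∀ {n} (L : List (Fin n)) {M} → Falling (L ++ M) → Falling M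
falling-++ʳ []      f       = f
falling-++ʳ (_ ∷ L) (_ ∷ f) = falling-++ʳ L f

falling-++ˡ : ∀ {n} (L : List (Fin n)) {M} → Falling (L ++ M) → Falling L
falling-++ˡ []      f       = []
falling-++ˡ (_ ∷ L) (p ∷ f) = All.++⁻ˡ L p ∷ falling-++ˡ L f

falling-++⇒> : ∀ {n} (L : List (Fin n)) {M x y} → Falling (L ++ M) → x ∈ˡ L → y ∈ˡ M → y Fin.< x
falling-++⇒> (_ ∷ L) (p ∷ _) (here refl) y∈M = All.lookup p (∈-++⁺ʳ L y∈M)
falling-++⇒> (_ ∷ L) (_ ∷ f) (there x∈L) y∈M = falling-++⇒> L f x∈L y∈M

falling-head : ∀ {n} {x y : Fin n} {L} → Falling (x ∷ L) → y ∈ˡ x ∷ L → y Fin.≤ x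
falling-head f       (here refl) = ℕ.≤-refl
falling-head (p ∷ _) (there y∈L) = ℕ.<⇒≤ (All.lookup p y∈L)

drop-head : ∀ {n} {x y : Fin n} {L} → y ∈ˡ x ∷ L → y Fin.< x → y ∈ˡ L
drop-head (here refl) y<x = ⊥-elim (ℕ.<-irrefl refl y<x)
drop-head (there y∈L) y<x = y∈L

-- Compare the heads, which are maxima. If the head of `L` is larger, it cannot belong to `S`; if
-- the head of `S` is larger, upward closure puts it into `L`, above the maximum of `L`.
upperSet⇒prefix : ∀ {n} (L S : List (Fin n)) → Falling L → Falling S →
  (∀ {x} → x ∈ˡ L → x ∈ˡ S) → (∀ {x z} → x ∈ˡ L → z ∈ˡ S → x Fin.< z → z ∈ˡ L) →
  ∃ λ S′ → S ≡ L ++ S′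
upperSet⇒prefix []      S       _       _       _   _  = S , refl
upperSet⇒prefix (x ∷ L) []      _       _       L⊆S _  with () ← L⊆S (here refl)
upperSet⇒prefix (x ∷ L) (z ∷ S) (p ∷ f) (q ∷ g) L⊆S up with Fin.<-cmp x z
... | tri> _ _ z<x = ⊥-elim (ℕ.<⇒≱ z<x (falling-head (q ∷ g) (L⊆S (here refl))))
... | tri< x<z _ _ = ⊥-elim (ℕ.<⇒≱ x<z (falling-head (p ∷ f) (up (here refl) (here refl) x<z)))
... | tri≈ _ refl _
  with S′ , refl ← upperSet⇒prefix L S f g
         (λ y∈L → drop-head (L⊆S (there y∈L)) (All.lookup p y∈L))
         (λ y∈L z∈S y<z → drop-head (up (there y∈L) (there z∈S) y<z) (All.lookup q z∈S))
  = S′ , refl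

falling-unique : ∀ {n} {L M : List (Fin n)} → Falling L → Falling M →
  (∀ {x} → x ∈ˡ L → x ∈ˡ M) → (∀ {x} → x ∈ˡ M → x ∈ˡ L) → L ≡ M
falling-unique {L = L} {M} f g L⊆M M⊆L
  with upperSet⇒prefix L M f g L⊆M (λ _ z∈M _ → M⊆L z∈M)
... | []     , refl = sym (List.++-identityʳ L)
... | z ∷ S′ , refl =
  ⊥-elim (ℕ.<-irrefl refl (falling-++⇒> L g (M⊆L (∈-insert L)) (here refl)))

falling-reverse : ∀ {n} (L : List (Fin n)) → AllPairs Fin._<_ L → Falling (reverse L)
falling-reverse []      []      = []
falling-reverse (x ∷ L) (p ∷ r) rewrite List.unfold-reverse x L =
  AllPairs.++⁺ (falling-reverse L r) ([] ∷ [])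
    (All.tabulate λ y∈ → All.lookup p (reverse⁻ y∈) ∷ [])

elements : ∀ {n} → Subset n → List (Fin n)
elements {n} t = filter (Subset._∈? t) (reverse (allFin n))

elements-falling : ∀ {n} (t : Subset n) → Falling (elements t)
elements-falling {n} t = AllPairs.filter⁺ (Subset._∈? t)
  (falling-reverse (allFin n) (AllPairs.tabulate⁺-< λ i<j → i<j))

∈-elements⁺ : ∀ {n} {t : Subset n} {x} → x ∈ˢ t → x ∈ˡ elements t
∈-elements⁺ {t = t} {x} x∈t = ∈-filter⁺ (Subset._∈? t) (reverse⁺ (∈-allFin x)) x∈t

∈-elements⁻ : ∀ {n} {t : Subset n} {x} → x ∈ˡ elements t → x ∈ˢ t
∈-elements⁻ {n} {t} x∈ = proj₂ (∈-filter⁻ (Subset._∈? t) {xs = reverse (allFin n)} x∈)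

elements-injective : ∀ {n} {t u : Subset n} → elements t ≡ elements u → t ≡ u
elements-injective eq = Subset.⊆-antisym
  (λ x∈t → ∈-elements⁻ (subst (_ ∈ˡ_) eq (∈-elements⁺ x∈t)))
  (λ x∈u → ∈-elements⁻ (subst (_ ∈ˡ_) (sym eq) (∈-elements⁺ x∈u)))

-- With `elements-injective`, this allows a row of a tree to be given as a decreasing list of
-- columns.
elements-surjective : ∀ {n} (L : List (Fin n)) → Falling L → ∃ λ t → elements t ≡ L
elements-surjective {n} L f = t , falling-unique (elements-falling t) f
  (λ x∈ → ∈t⁻ (∈-elements⁻ x∈)) (λ x∈ → ∈-elements⁺ (∈t⁺ x∈))
  where
  open import Data.List.Membership.DecPropositional (Fin._≟_ {n}) using () renaming (_∈?_ to _∈ˡ?_)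
  t : Subset n
  t = Vec.tabulate (λ x → does (x ∈ˡ? L))
  ∈t⁺ : ∀ {x} → x ∈ˡ L → x ∈ˢ t
  ∈t⁺ {x} x∈L = Vec.lookup⇒[]= x t (trans (Vec.lookup∘tabulate _ x) (dec-true (x ∈ˡ? L) x∈L))
  ∈t⁻ : ∀ {x} → x ∈ˢ t → x ∈ˡ L
  ∈t⁻ {x} x∈t
    with x ∈ˡ? L
       | trans (sym (Vec.lookup∘tabulate (λ x → does (x ∈ˡ? L)) x)) (Vec.[]=⇒lookup x∈t)
  ... | yes x∈L | _ = x∈L

-- Step counts of words, and the row lengths of the region

norths : List Step → ℕ
norths []      = 0
norths (N ∷ w) = suc (norths w)
norths (E ∷ w) = norths w
norths (D ∷ w) = suc (norths w)

easts : List Step → ℕ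
easts []      = 0
easts (N ∷ w) = easts w
easts (E ∷ w) = suc (easts w)
easts (D ∷ w) = suc (easts w)

foldl-move : ∀ x y w → foldl move (x , y) w ≡ (x + easts w , y + norths w)
foldl-move x y []      = cong₂ _,_ (sym (ℕ.+-identityʳ x)) (sym (ℕ.+-identityʳ y))
foldl-move x y (N ∷ w) = trans (foldl-move x (suc y) w) (cong (x + easts w ,_) (sym (ℕ.+-suc y _)))
foldl-move x y (E ∷ w) = trans (foldl-move (suc x) y w) (cong (_, y + norths w) (sym (ℕ.+-suc x _)))
foldl-move x y (D ∷ w) = trans (foldl-move (suc x) (suc y) w)
  (cong₂ _,_ (sym (ℕ.+-suc x _)) (sym (ℕ.+-suc y _)))

endsAt⇒easts : ∀ {b a} w → EndsAt (b , a) w → easts w ≡ b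
endsAt⇒easts w e = cong proj₁ (trans (sym (foldl-move 0 0 w)) e)

endsAt⇒norths : ∀ {b a} w → EndsAt (b , a) w → norths w ≡ a
endsAt⇒norths w e = cong proj₂ (trans (sym (foldl-move 0 0 w)) e)

length-segments : ∀ h w → length (segments h w) ≡ easts w
length-segments h []      = refl
length-segments h (N ∷ w) = length-segments (suc h) w
length-segments h (E ∷ w) = cong suc (length-segments h w)
length-segments h (D ∷ w) = cong suc (length-segments (suc h) w)

-- `reach c ν y` is the number of columns met by the row y of the region above
-- ν, if c of them are met by row 0 before ν starts.
reach : ℕ → List Step → ℕ → ℕ
reach c []      y       = c
reach c (E ∷ ν) y       = reach (suc c) ν y
reach c (N ∷ ν) zero    = c
reach c (N ∷ ν) (suc y) = reach c ν y
reach c (D ∷ ν) zero    = c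
reach c (D ∷ ν) (suc y) = reach (suc c) ν y

reach-≥ : ∀ c ν y → c ≤ reach c ν y
reach-≥ c []      y       = ℕ.≤-refl
reach-≥ c (E ∷ ν) y       = ℕ.<⇒≤ (reach-≥ (suc c) ν y)
reach-≥ c (N ∷ ν) zero    = ℕ.≤-refl
reach-≥ c (N ∷ ν) (suc y) = reach-≥ c ν y
reach-≥ c (D ∷ ν) zero    = ℕ.≤-refl
reach-≥ c (D ∷ ν) (suc y) = ℕ.<⇒≤ (reach-≥ (suc c) ν y)

reach-mono : ∀ c ν {y z} → y ≤ z → reach c ν y ≤ reach c ν z
reach-mono c []      y≤z               = ℕ.≤-refl
reach-mono c (E ∷ ν) y≤z               = reach-mono (suc c) ν y≤z
reach-mono c (N ∷ ν) {z = z} z≤n       = reach-≥ c (N ∷ ν) z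
reach-mono c (N ∷ ν) (s≤s y≤z)         = reach-mono c ν y≤z
reach-mono c (D ∷ ν) {z = z} z≤n       = reach-≥ c (D ∷ ν) z
reach-mono c (D ∷ ν) (s≤s y≤z)         = reach-mono (suc c) ν y≤z

vertices-≥ : ∀ i k ν {x h} → (x , h) ∈ˡ vertices (i , k) ν → k ≤ h
vertices-≥ i k []      (here refl) = ℕ.≤-refl
vertices-≥ i k (s ∷ ν) (here refl) = ℕ.≤-refl
vertices-≥ i k (N ∷ ν) (there v)   = ℕ.<⇒≤ (vertices-≥ i (suc k) ν v)
vertices-≥ i k (E ∷ ν) (there v)   = vertices-≥ (suc i) k ν v
vertices-≥ i k (D ∷ ν) (there v)   = ℕ.<⇒≤ (vertices-≥ (suc i) (suc k) ν v)

-- With the converse `reach⇒vertices`, membership in the region becomes a numerical bound. The count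
-- starts at `suc i` because the columns 0 to `i` are met by the time `ν` is in column `i`.
vertices⇒reach : ∀ i k ν {x h y} → (x , h) ∈ˡ vertices (i , k) ν → h ≤ k + y → x < reach (suc i) ν y
vertices⇒reach i k []      (here refl) _ = ℕ.≤-refl
vertices⇒reach i k (s ∷ ν) (here refl) _ = reach-≥ (suc i) (s ∷ ν) _
vertices⇒reach i k (E ∷ ν) (there v) h≤ = vertices⇒reach (suc i) k ν v h≤
vertices⇒reach i k (N ∷ ν) {y = zero} (there v) h≤ =
  ⊥-elim (ℕ.<⇒≱ (vertices-≥ i (suc k) ν v) (subst (_ ≤_) (ℕ.+-identityʳ k) h≤))
vertices⇒reach i k (N ∷ ν) {h = h} {suc y} (there v) h≤ =
  vertices⇒reach i (suc k) ν v (subst (h ≤_) (ℕ.+-suc k y) h≤)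
vertices⇒reach i k (D ∷ ν) {y = zero} (there v) h≤ =
  ⊥-elim (ℕ.<⇒≱ (vertices-≥ (suc i) (suc k) ν v) (subst (_ ≤_) (ℕ.+-identityʳ k) h≤))
vertices⇒reach i k (D ∷ ν) {h = h} {suc y} (there v) h≤ =
  vertices⇒reach (suc i) (suc k) ν v (subst (h ≤_) (ℕ.+-suc k y) h≤)

reach⇒vertices : ∀ i k ν {x} y → i ≤ x → x < reach (suc i) ν y →
  ∃ λ h → (x , h) ∈ˡ vertices (i , k) ν × h ≤ k + y
reach⇒vertices i k ν {x} y i≤x x< with ℕ.m≤n⇒m<n∨m≡n i≤x
reach⇒vertices i k []      y i≤x x< | inj₂ refl = k , here refl , ℕ.m≤m+n k y
reach⇒vertices i k (s ∷ ν) y i≤x x< | inj₂ refl = k , here refl , ℕ.m≤m+n k y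
reach⇒vertices i k []      y       i≤x x< | inj₁ i<x = ⊥-elim (ℕ.<⇒≱ i<x (s≤s⁻¹ x<))
reach⇒vertices i k (E ∷ ν) y       i≤x x< | inj₁ i<x
  with h , v , h≤ ← reach⇒vertices (suc i) k ν y i<x x< = h , there v , h≤
reach⇒vertices i k (N ∷ ν) zero    i≤x x< | inj₁ i<x = ⊥-elim (ℕ.<⇒≱ i<x (s≤s⁻¹ x<))
reach⇒vertices i k (N ∷ ν) (suc y) i≤x x< | inj₁ i<x
  with h , v , h≤ ← reach⇒vertices i (suc k) ν y i≤x x< =
  h , there v , subst (h ≤_) (sym (ℕ.+-suc k y)) h≤
reach⇒vertices i k (D ∷ ν) zero    i≤x x< | inj₁ i<x = ⊥-elim (ℕ.<⇒≱ i<x (s≤s⁻¹ x<))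
reach⇒vertices i k (D ∷ ν) (suc y) i≤x x< | inj₁ i<x
  with h , v , h≤ ← reach⇒vertices (suc i) (suc k) ν y i<x x< =
  h , there v , subst (h ≤_) (sym (ℕ.+-suc k y)) h≤

-- Sweeps, relating trees, stacks and words

-- What becomes of the lowest column m of a row, and of the stack below m, when
-- m is read as the given step.
data Turn {n} (m : Fin n) : Step → List (Fin n) → List (Fin n) → Set where
  keep : ∀ {S} → Turn m N S (m ∷ S)
  drop : ∀ {z S} → Turn m D (z ∷ S) (z ∷ S)

-- T : the rows not yet removed; c : the next column of ν to be uncovered;
-- S : the surviving columns left of c, rightmost first (never emptied, because
-- column 0 carries the root); ν and w : what remains to be read of both paths.
data Sweep {n} : ∀ {k} → Vec (Subset n) (suc k) → ℕ → List (Fin n) →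
                 List Step → List Step → Set where
  push : ∀ {k} {T : Vec (Subset n) (suc k)} {c x S ν w} → toℕ x ≡ c →
         Sweep T (suc c) (x ∷ S) ν w → Sweep T c S (E ∷ ν) w
  row  : ∀ {k t} {T : Vec (Subset n) (suc k)} {c L m s S S′ ν w} →
         elements t ≡ L ++ [ m ] → Turn m s S S′ → Sweep T c S′ ν w →
         Sweep (t ∷ T) c (L ++ m ∷ S) (N ∷ ν) (replicate (length L) E ++ s ∷ w)
  last : ∀ {t c L m} → elements t ≡ L ++ [ m ] →
         Sweep (t ∷ []) c (L ++ [ m ]) [] (replicate (length L) E)

-- Stacks of columns, and the passage between trees and sweeps

module _ {n : ℕ} where

  record Stack (c : ℕ) (S : List (Fin (suc n))) : Set where
    field
      falling : Falling S
      below   : ∀ {x} → x ∈ˡ S → toℕ x < c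
      base    : zero ∈ˡ S

  open Stack

  push-stack : ∀ {c S x} → toℕ x ≡ c → Stack c S → Stack (suc c) (x ∷ S)
  push-stack refl σ .falling = All.tabulate (σ .below) ∷ σ .falling
  push-stack refl σ .below (here refl) = ℕ.≤-refl
  push-stack refl σ .below (there x∈S) = ℕ.m≤n⇒m≤1+n (σ .below x∈S)
  push-stack refl σ .base = there (σ .base)

  -- Column 0 is the smallest, so in a falling stack it cannot lie in `L`, before `z`; removing `L`
  -- leaves the base in place.
  drop-stack : ∀ {c} L {z S} → Stack c (L ++ z ∷ S) → Stack c (z ∷ S)
  drop-stack L σ .falling = falling-++ʳ L (σ .falling)
  drop-stack L σ .below x∈ = σ .below (∈-++⁺ʳ L x∈)
  drop-stack L σ .base with ∈-++⁻ L (σ .base)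
  ... | inj₁ 0∈L = ⊥-elim (ℕ.n≮0 (falling-++⇒> L (σ .falling) 0∈L (here refl)))
  ... | inj₂ 0∈  = 0∈

  turn-stack : ∀ {c} L {m s S S′} → Turn m s S S′ → Stack c (L ++ m ∷ S) → Stack c S′
  turn-stack L keep       σ = drop-stack L σ
  turn-stack L {m} drop σ = drop-stack [ m ] (drop-stack L σ)

  turn-⊆ : ∀ {m : Fin (suc n)} {s S S′ x} → Turn m s S S′ → x ∈ˡ S′ → x ∈ˡ m ∷ S
  turn-⊆ keep x∈ = x∈
  turn-⊆ drop x∈ = there x∈

  turn-⊇ : ∀ {m : Fin (suc n)} {s S S′ x} → Turn m s S S′ → x ∈ˡ S → x ∈ˡ S′
  turn-⊇ keep x∈ = there x∈
  turn-⊇ drop x∈ = x∈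

  -- The columns in which remaining rows may have points; `c ≤ toℕ x` means that `ν` has yet to
  -- uncover the column.
  Alive : ℕ → List (Fin (suc n)) → Fin (suc n) → Set
  Alive c S x = x ∈ˡ S ⊎ c ≤ toℕ x

  -- An E step of `ν` moves column `c` from the uncovered-later columns to the stack. With
  -- `push-alive⁻`, the set of alive columns stays the same, so a `push` preserves `UpperRows`.
  push-alive : ∀ {c S x z} → toℕ x ≡ c → Alive c S z → Alive (suc c) (x ∷ S) z
  push-alive refl (inj₁ z∈S) = inj₁ (there z∈S)
  push-alive refl (inj₂ c≤z) with ℕ.m≤n⇒m<n∨m≡n c≤z
  ... | inj₁ c<z = inj₂ c<z
  ... | inj₂ x≡z = inj₁ (here (Fin.toℕ-injective (sym x≡z)))

  push-alive⁻ : ∀ {c S x z} → toℕ x ≡ c → Alive (suc c) (x ∷ S) z → Alive c S z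
  push-alive⁻ refl (inj₁ (here refl)) = inj₂ ℕ.≤-refl
  push-alive⁻ refl (inj₁ (there z∈S)) = inj₁ z∈S
  push-alive⁻ refl (inj₂ c<z)         = inj₂ (ℕ.<⇒≤ c<z)

  ∈-assoc⁻ : ∀ L {m x : Fin (suc n)} {S} → x ∈ˡ L ++ m ∷ S → x ∈ˡ L ++ [ m ] ⊎ x ∈ˡ S
  ∈-assoc⁻ L {m} {S = S} x∈ = ∈-++⁻ (L ++ [ m ]) (subst (_ ∈ˡ_) (sym (List.++-assoc L [ m ] S)) x∈)

  ∈-assoc⁺ : ∀ L {m x : Fin (suc n)} {S} → x ∈ˡ L ++ [ m ] → x ∈ˡ L ++ m ∷ S
  ∈-assoc⁺ L {m} {S = S} x∈ = subst (_ ∈ˡ_) (List.++-assoc L [ m ] S) (∈-++⁺ˡ x∈)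

  -- Entries of the row precede `S` in the falling stack and are smaller than `c`, so neither
  -- alternative of `Alive` can hold.
  alive-unique : ∀ {c} L {m S x} → Stack c (L ++ m ∷ S) → x ∈ˡ L ++ [ m ] → ¬ Alive c S x
  alive-unique L {m} {S} σ x∈ (inj₁ x∈S) = ℕ.<-irrefl refl
    (falling-++⇒> (L ++ [ m ]) (subst Falling (sym (List.++-assoc L [ m ] S)) (σ .falling)) x∈ x∈S)
  alive-unique L σ x∈ (inj₂ c≤x) = ℕ.<⇒≱ (σ .below (∈-assoc⁺ L x∈)) c≤x

  -- The rows T of a ν-Schröder tree which are left once the rows below them,
  -- and the columns ending there, have been removed.
  record UpperRows {k} (T : Vec (Subset (suc n)) (suc k)) (c : ℕ) (S : List (Fin (suc n)))
                   (ν : List Step) : Set where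
    field
      height     : norths ν ≡ k
      alive      : ∀ {x} y → x ∈ˢ lookup T y → Alive c S x
      inReach    : ∀ {x} y → x ∈ˢ lookup T y → toℕ x < reach c ν (toℕ y)
      compatible : ∀ {x x′} y y′ → x ∈ˢ lookup T y → x′ ∈ˢ lookup T y′ →
                   y Fin.< y′ → x Fin.< x′ → ¬ toℕ x′ < reach c ν (toℕ y)
      hasRoot    : zero ∈ˢ lookup T (fromℕ k)
      rows       : ∀ y → ∃ λ x → x ∈ˢ lookup T y
      columns    : ∀ {x} → Alive c S x → ∃ λ y → x ∈ˢ lookup T y

  open UpperRows

  module _ {t : Subset (suc n)} {R} (eq : elements t ≡ R) where

    ∈-row⁺ : ∀ {x} → x ∈ˢ t → x ∈ˡ R
    ∈-row⁺ x∈t = subst (_ ∈ˡ_) eq (∈-elements⁺ x∈t)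

    ∈-row⁻ : ∀ {x} → x ∈ˡ R → x ∈ˢ t
    ∈-row⁻ x∈R = ∈-elements⁻ (subst (_ ∈ˡ_) (sym eq) x∈R)

  row-≥ : ∀ L {m x : Fin (suc n)} → Falling (L ++ [ m ]) → x ∈ˡ L ++ [ m ] → m Fin.≤ x
  row-≥ L f x∈ with ∈-++⁻ L x∈
  ... | inj₁ x∈L         = ℕ.<⇒≤ (falling-++⇒> L f x∈L (here refl))
  ... | inj₂ (here refl) = ℕ.≤-refl

  sweep⇒upperRows : ∀ {k c S ν w} {T : Vec (Subset (suc n)) (suc k)} →
    Stack c S → c + easts ν ≡ suc n → Sweep T c S ν w → UpperRows T c S ν
  sweep⇒upperRows {c = c} {S} {E ∷ ν} {T = T} σ width (push {x = x} x≡c sw) = record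
    { height     = IH .height
    ; alive      = λ y z∈ → push-alive⁻ x≡c (IH .alive y z∈)
    ; inReach    = IH .inReach
    ; compatible = IH .compatible
    ; hasRoot    = IH .hasRoot
    ; rows       = IH .rows
    ; columns    = IH .columns ∘ push-alive x≡c
    }
    where
    IH : UpperRows T (suc c) (x ∷ S) ν
    IH = sweep⇒upperRows (push-stack x≡c σ) (trans (sym (ℕ.+-suc c _)) width) sw
  sweep⇒upperRows {c = c} σ width (row {k} {t} {T} {L = L} {m} {S = S} {S′} {ν} eq turn sw) = record
    { height     = cong suc (IH .height)
    ; alive      = al
    ; inReach    = ir
    ; compatible = comp
    ; hasRoot    = IH .hasRoot
    ; rows       = λ { zero → m , ∈-row⁻ eq (∈-insert L) ; (suc y) → IH .rows y }
    ; columns    = cols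
    }
    where
    IH : UpperRows T c S′ ν
    IH = sweep⇒upperRows (turn-stack L turn σ) width sw
    rowFalling : Falling (L ++ [ m ])
    rowFalling = subst Falling eq (elements-falling t)
    al : ∀ {x} y → x ∈ˢ lookup (t ∷ T) y → Alive c (L ++ m ∷ S) x
    al zero    x∈ = inj₁ (∈-assoc⁺ L (∈-row⁺ eq x∈))
    al (suc y) x∈ with IH .alive y x∈
    ... | inj₁ x∈S′ = inj₁ (∈-++⁺ʳ L (turn-⊆ turn x∈S′))
    ... | inj₂ c≤x  = inj₂ c≤x
    ir : ∀ {x} y → x ∈ˢ lookup (t ∷ T) y → toℕ x < reach c (N ∷ ν) (toℕ y)
    ir zero    x∈ = σ .below (∈-assoc⁺ L (∈-row⁺ eq x∈))
    ir (suc y) x∈ = IH .inReach y x∈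
    comp : ∀ {x x′} y y′ → x ∈ˢ lookup (t ∷ T) y → x′ ∈ˢ lookup (t ∷ T) y′ →
           y Fin.< y′ → x Fin.< x′ → ¬ toℕ x′ < reach c (N ∷ ν) (toℕ y)
    -- A higher point has its column either on `S′`, hence at or left of `m` and so of `x`, or
    -- beyond the reach `c` of the bottom row.
    comp zero (suc y′) x∈ x′∈ _ x<x′ x′<c with IH .alive y′ x′∈
    ... | inj₁ x′∈S′ = ℕ.<⇒≱ x<x′ (ℕ.≤-trans
            (falling-head (falling-++ʳ L (σ .falling)) (turn-⊆ turn x′∈S′))
            (row-≥ L rowFalling (∈-row⁺ eq x∈)))
    ... | inj₂ c≤x′  = ℕ.<⇒≱ x′<c c≤x′
    comp (suc y) (suc y′) x∈ x′∈ y<y′ = IH .compatible y y′ x∈ x′∈ (s≤s⁻¹ y<y′)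
    cols : ∀ {x} → Alive c (L ++ m ∷ S) x → ∃ λ y → x ∈ˢ lookup (t ∷ T) y
    cols (inj₁ x∈) with ∈-assoc⁻ L x∈
    ... | inj₁ x∈row = zero , ∈-row⁻ eq x∈row
    ... | inj₂ x∈S with y , x∈y ← IH .columns (inj₁ (turn-⊇ turn x∈S)) = suc y , x∈y
    cols (inj₂ c≤x) with y , x∈y ← IH .columns (inj₂ c≤x) = suc y , x∈y
  sweep⇒upperRows {c = c} σ width (last {t} {L = L} {m} eq) = record
    { height     = refl
    ; alive      = λ { zero x∈ → inj₁ (∈-row⁺ eq x∈) }
    ; inReach    = λ { zero x∈ → σ .below (∈-row⁺ eq x∈) }
    ; compatible = λ { zero zero _ _ () }
    -- The last row is the whole stack, so it contains column 0.
    ; hasRoot    = ∈-row⁻ eq (σ .base)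
    ; rows       = λ { zero → m , ∈-row⁻ eq (∈-insert L) }
    ; columns    = λ { (inj₁ x∈S) → zero , ∈-row⁻ eq x∈S
                     -- With `ν` exhausted, `width` makes `c` the total number of columns, so none
                     -- remains to be uncovered.
                     ; {x} (inj₂ c≤x) → ⊥-elim (ℕ.<⇒≱ (Fin.toℕ<n x)
                         (subst (_≤ toℕ x) (trans (sym (ℕ.+-identityʳ c)) width) c≤x)) }
    }

  unsnoc : ∀ {x : Fin (suc n)} {R} → x ∈ˡ R → ∃ λ L → ∃ λ m → R ≡ L ++ [ m ]
  unsnoc {R = z ∷ []}    _           = [] , z , refl
  unsnoc {R = z ∷ y ∷ R} _
    with L , m , eq ← unsnoc {R = y ∷ R} (here refl) = z ∷ L , m , cong (z ∷_) eq

  newColumn : ∀ c e → c + suc e ≡ suc n → ∃ λ (x : Fin (suc n)) → toℕ x ≡ c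
  newColumn c e width = fromℕ< c<n , Fin.toℕ-fromℕ< c<n
    where
    c<n : c < suc n
    c<n = subst (c <_) width (ℕ.m<m+n c (s≤s z≤n))

  alive-below : ∀ {c S x} → Alive c S x → toℕ x < c → x ∈ˡ S
  alive-below (inj₁ x∈S) _   = x∈S
  alive-below (inj₂ c≤x) x<c = ⊥-elim (ℕ.<⇒≱ x<c c≤x)

  -- The hypothesis on `reach` says that `ν` has no E step left at the current height, so the bottom
  -- row meets no column from `c` on.
  row⊆stack : ∀ {k c S ν} {T : Vec (Subset (suc n)) (suc k)} → UpperRows T c S ν → reach c ν 0 ≡ c →
    ∀ {x} → x ∈ˢ lookup T zero → x ∈ˡ S
  row⊆stack U refl-reach x∈ = alive-below (U .alive zero x∈) (subst (_ <_) refl-reach (U .inReach zero x∈))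

  row-upper : ∀ {k c S ν t} {T : Vec (Subset (suc n)) k} →
    Stack c S → UpperRows (t ∷ T) c S ν → reach c ν 0 ≡ c →
    ∀ {x z} → x ∈ˢ t → z ∈ˡ S → x Fin.< z → z ∈ˢ t
  row-upper σ U r x∈ z∈S x<z with U .columns (inj₁ z∈S)
  ... | zero  , z∈ = z∈
  ... | suc y , z∈ = ⊥-elim
    (U .compatible zero (suc y) x∈ z∈ (s≤s z≤n) x<z (subst (_ <_) (sym r) (σ .below z∈S)))

  -- A stack column right of the leftmost point (m , 0) can only be occupied in
  -- row 0, since the rectangle from (m , 0) to any point above lies in the region.
  row-prefix : ∀ {k c S ν t} {T : Vec (Subset (suc n)) k} →
    Stack c S → UpperRows (t ∷ T) c S ν → reach c ν 0 ≡ c →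
    ∃ λ L → ∃ λ m → ∃ λ S₁ → elements t ≡ L ++ [ m ] × S ≡ L ++ m ∷ S₁
  row-prefix {S = S} {t = t} σ U r
    with L , m , eq ← unsnoc (∈-elements⁺ (proj₂ (U .rows zero)))
    with S₁ , S≡ ← upperSet⇒prefix (L ++ [ m ]) S (subst Falling eq (elements-falling t)) (σ .falling)
           (λ x∈ → row⊆stack U r (∈-row⁻ eq x∈))
           (λ x∈ z∈S x<z → ∈-row⁺ eq (row-upper σ U r (∈-row⁻ eq x∈) z∈S x<z))
    = L , m , S₁ , eq , trans S≡ (List.++-assoc L [ m ] S₁)

  module _ {k c L m S ν t} {T : Vec (Subset (suc n)) (suc k)} (σ : Stack c (L ++ m ∷ S))
           (eq : elements t ≡ L ++ [ m ]) (U : UpperRows (t ∷ T) c (L ++ m ∷ S) (N ∷ ν)) where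

    -- A higher point in a column of `L` would be strictly northeast of the bottom point in column
    -- `m` and still within the reach of the bottom row. So all columns of `L` end here.
    alive-above : ∀ {x} y → x ∈ˢ lookup T y → Alive c (m ∷ S) x
    alive-above y x∈ with U .alive (suc y) x∈
    ... | inj₂ c≤x = inj₂ c≤x
    ... | inj₁ x∈S with ∈-++⁻ L x∈S
    ...   | inj₂ x∈mS = inj₁ x∈mS
    ...   | inj₁ x∈L  = ⊥-elim (U .compatible zero (suc y) (∈-row⁻ eq (∈-insert L)) x∈ (s≤s z≤n)
                          (falling-++⇒> L (σ .falling) x∈L (here refl)) (σ .below x∈S))

    -- An alive column has its point somewhere, and by `alive-unique` not in the removed row.
    columns-above : ∀ {x} → Alive c S x → ∃ λ y → x ∈ˢ lookup T y
    columns-above x-alive with U .columns (Sum.map₁ (∈-++⁺ʳ L ∘ there) x-alive)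
    ... | suc y , x∈ = y , x∈
    ... | zero  , x∈ = ⊥-elim (alive-unique L σ (∈-row⁺ eq x∈) x-alive)

    rest : ∀ {S′} → (∀ {x} y → x ∈ˢ lookup T y → Alive c S′ x) →
           (∀ {x} → Alive c S′ x → ∃ λ y → x ∈ˢ lookup T y) → UpperRows T c S′ ν
    rest al cols = record
      { height     = ℕ.suc-injective (U .height)
      ; alive      = al
      ; inReach    = U .inReach ∘ suc
      ; compatible = λ y y′ x∈ x′∈ y<y′ → U .compatible (suc y) (suc y′) x∈ x′∈ (s≤s y<y′)
      ; hasRoot    = U .hasRoot
      ; rows       = U .rows ∘ suc
      ; columns    = cols
      }

    -- Once the columns of `L` are gone, one alternative is left: whether column `m` has a point
    -- higher up. It selects `keep` with N or `drop` with D.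
    turn : ∃ λ s → ∃ λ S′ → Turn m s S S′ × UpperRows T c S′ ν
    turn with Fin.any? (λ y → m Subset.∈? lookup T y)
    ... | yes m-above = N , m ∷ S , keep , rest alive-above cols
      where
      cols : ∀ {x} → Alive c (m ∷ S) x → ∃ λ y → x ∈ˢ lookup T y
      cols (inj₁ (here refl)) = m-above
      cols (inj₁ (there x∈S)) = columns-above (inj₁ x∈S)
      cols (inj₂ c≤x)         = columns-above (inj₂ c≤x)
    ... | no ¬m-above = D , S , dropped (al _ (U .hasRoot)) , rest al columns-above
      where
      al : ∀ {x} y → x ∈ˢ lookup T y → Alive c S x
      al y x∈ with alive-above y x∈
      ... | inj₁ (here refl) = ⊥-elim (¬m-above (y , x∈))
      ... | inj₁ (there x∈S) = inj₁ x∈S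
      ... | inj₂ c≤x         = inj₂ c≤x
      -- `drop` requires a nonempty stack below `m`. The root lies higher up, so column 0 is alive,
      -- and being left of `c` it is on that stack.
      dropped : ∀ {S} → Alive c S zero → Turn m D S S
      dropped {_ ∷ _} _   = drop
      dropped {[]} (inj₂ c≤0) = ⊥-elim (ℕ.<⇒≱ (σ .below (σ .base)) c≤0)

  -- Recursion on `ν`: an E step uncovers a column, an N step removes a row. The word is produced
  -- along the way, since the tree determines each turn.
  upperRows⇒sweep : ∀ {k} (T : Vec (Subset (suc n)) (suc k)) {c S ν} → All (_≢ D) ν →
    Stack c S → c + easts ν ≡ suc n → UpperRows T c S ν → ∃ (Sweep T c S ν)
  upperRows⇒sweep T {ν = D ∷ ν} (D≢D ∷ _) _ _ _ = ⊥-elim (D≢D refl)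
  upperRows⇒sweep T {c} {ν = E ∷ ν} (_ ∷ noD) σ width U
    with x , x≡c ← newColumn c (easts ν) width
    with w , sw ← upperRows⇒sweep T noD (push-stack x≡c σ) (trans (sym (ℕ.+-suc c _)) width) (record
           { height     = U .height
           ; alive      = λ y z∈ → push-alive x≡c (U .alive y z∈)
           ; inReach    = U .inReach
           ; compatible = U .compatible
           ; hasRoot    = U .hasRoot
           ; rows       = U .rows
           ; columns    = U .columns ∘ push-alive⁻ x≡c
           })
    = w , push x≡c sw
  upperRows⇒sweep {suc k} (t ∷ T) {ν = []} _ _ _ U with () ← U .height
  upperRows⇒sweep {zero} (t ∷ []) {S = S} {ν = []} _ σ _ U
    with row-prefix σ U refl
  ... | L , m , []     , eq , refl = _ , last eq
  -- A further stack column would need a point in the only row left, which ends with `m`.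
  ... | L , m , x ∷ S₁ , eq , refl with U .columns (inj₁ (∈-++⁺ʳ L (there (here refl))))
  ...   | zero , x∈ = ⊥-elim (alive-unique L σ (∈-row⁺ eq x∈) (inj₁ (here refl)))
  upperRows⇒sweep {zero} (t ∷ []) {ν = N ∷ ν} _ _ _ U with () ← U .height
  upperRows⇒sweep {suc k} (t ∷ T) {ν = N ∷ ν} (_ ∷ noD) σ width U
    with L , m , S , eq , refl ← row-prefix σ U refl
    with s , S′ , τ , U′ ← turn {L = L} σ eq U
    with w , sw ← upperRows⇒sweep T noD (turn-stack L τ σ) width U′
    = _ , row eq τ sw

-- Sweeps and words weakly above `ν`

_⊑_ : ℕ × ℕ → ℕ × ℕ → Set
(l , r) ⊑ (l′ , r′) = l ≤ l′ × r ≤ r′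

-- Segments that any E or D step of `w` starting at height `h` passes weakly above.
Low : ℕ → List (ℕ × ℕ) → Set
Low h = All (_⊑ (h , h))

low-suc : ∀ {h Q} → Low h Q → Low (suc h) Q
low-suc = All.map λ (l≤ , r≤) → ℕ.m≤n⇒m≤1+n l≤ , ℕ.m≤n⇒m≤1+n r≤

length-∷ʳ : ∀ {A : Set} (Q : List A) {x} → length (Q ++ [ x ]) ≡ suc (length Q)
length-∷ʳ Q = trans (List.length-++ Q) (ℕ.+-comm (length Q) 1)

module _ {n : ℕ} where

  -- Each E step at height `h` is matched with the front of the queue, where `Low` suffices; the
  -- continuation treats what follows. The length equation keeps the queue from running out first.
  segments-replicate : ∀ {h X S w} (L : List (Fin n)) {m} Q →
    length (L ++ m ∷ S) ≡ suc (length Q) → Low h Q →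
    (∀ Q → length S ≡ length Q → Low h Q → Pointwise _⊑_ (Q ++ X) (segments h w)) →
    Pointwise _⊑_ (Q ++ X) (segments h (replicate (length L) E ++ w))
  segments-replicate []      Q       len low      k = k Q (ℕ.suc-injective len) low
  segments-replicate (_ ∷ [])    [] ()  low k
  segments-replicate (_ ∷ _ ∷ _) [] ()  low k
  segments-replicate (x ∷ L) (q ∷ Q) len (l ∷ ls) k =
    l ∷ segments-replicate L Q (ℕ.suc-injective len) ls k

  -- ν runs ahead of w: the queue Q holds the segments of ν over the columns
  -- (except column 0) that are still on the stack.
  sweep⇒above : ∀ {k h c S ν w} {T : Vec (Subset n) (suc k)} → Sweep T c S ν w →
    ∀ Q → length S ≡ suc (length Q) → Low h Q → Pointwise _⊑_ (Q ++ segments h ν) (segments h w)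
  sweep⇒above {h = h} {ν = E ∷ ν} (push _ sw) Q len low =
    subst (λ X → Pointwise _⊑_ X _) (List.++-assoc Q [ h , h ] (segments h ν))
      (sweep⇒above sw (Q ++ [ h , h ]) (cong suc (trans len (sym (length-∷ʳ Q))))
        (All.++⁺ low ((ℕ.≤-refl , ℕ.≤-refl) ∷ [])))
  sweep⇒above {h = h} {ν = N ∷ ν} (row {L = L} {s = s} {w = w} _ τ sw) Q len low =
    segments-replicate L Q len low (turned τ sw)
    where
    turned : ∀ {k m s S S′ c w} {T : Vec (Subset n) (suc k)} → Turn m s S S′ → Sweep T c S′ ν w →
             ∀ Q → length S ≡ length Q → Low h Q →
             Pointwise _⊑_ (Q ++ segments (suc h) ν) (segments h (s ∷ w))
    turned keep sw Q       len low            = sweep⇒above sw Q (cong suc len) (low-suc low)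
    turned drop sw (q ∷ Q) len ((l , r) ∷ ls) =
      (l , ℕ.m≤n⇒m≤1+n r) ∷ sweep⇒above sw Q len (low-suc ls)
  sweep⇒above {h = h} (last {L = L} _) Q len low =
    subst (λ w → Pointwise _⊑_ (Q ++ []) (segments h w)) (List.++-identityʳ (replicate (length L) E))
      (segments-replicate {w = []} L Q len low λ { [] _ _ → [] })

  norths-replicate : ∀ i w → norths (replicate i E ++ w) ≡ norths w
  norths-replicate zero    w = refl
  norths-replicate (suc i) w = norths-replicate i w

  sweep⇒norths : ∀ {k c S ν w} {T : Vec (Subset n) (suc k)} → Sweep T c S ν w → norths w ≡ k
  sweep⇒norths (push _ sw) = sweep⇒norths sw
  sweep⇒norths (row {L = L} {s = s} {w = w} _ keep sw) =
    trans (norths-replicate (length L) (s ∷ w)) (cong suc (sweep⇒norths sw))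
  sweep⇒norths (row {L = L} {s = s} {w = w} _ drop sw) =
    trans (norths-replicate (length L) (s ∷ w)) (cong suc (sweep⇒norths sw))
  sweep⇒norths (last {L = L} _) =
    trans (cong norths (sym (List.++-identityʳ (replicate (length L) E)))) (norths-replicate (length L) [])

  -- A turn never reads E, so the initial run of E steps fixes the length of `L` and, the stacks
  -- being equal, the row. The letter after the run fixes the turn.
  sameRow : ∀ (L L′ : List (Fin n)) {m m′ S₁ S₁′ S S′ s s′ w w′} →
    Turn m s S₁ S → Turn m′ s′ S₁′ S′ →
    L ++ m ∷ S₁ ≡ L′ ++ m′ ∷ S₁′ →
    replicate (length L) E ++ s ∷ w ≡ replicate (length L′) E ++ s′ ∷ w′ →
    L ++ [ m ] ≡ L′ ++ [ m′ ] × S ≡ S′ × w ≡ w′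
  sameRow [] [] keep keep refl refl = refl , refl , refl
  sameRow [] [] keep drop _    ()
  sameRow [] [] drop keep _    ()
  sameRow [] [] drop drop refl refl = refl , refl , refl
  sameRow [] (_ ∷ _) keep _ _ ()
  sameRow [] (_ ∷ _) drop _ _ ()
  sameRow (_ ∷ _) [] _ keep _ ()
  sameRow (_ ∷ _) [] _ drop _ ()
  sameRow (x ∷ L) (x′ ∷ L′) τ τ′ S≡ w≡
    with refl ← List.∷-injectiveˡ S≡
    with R≡ , S≡ , w≡ ← sameRow L L′ τ τ′ (List.∷-injectiveʳ S≡) (List.∷-injectiveʳ w≡)
    = cong (x ∷_) R≡ , S≡ , w≡

  -- This gives injectivity of `φ`. Equality of stacks and words is passed as arguments because
  -- indices built with `_++_` and `replicate` do not unify.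
  sweep-deterministic : ∀ {k c S S′ ν w w′} {T T′ : Vec (Subset n) (suc k)} →
    Sweep T c S ν w → Sweep T′ c S′ ν w′ → S ≡ S′ → w ≡ w′ → T ≡ T′
  sweep-deterministic (push x≡c sw) (push x′≡c sw′) S≡ w≡ =
    sweep-deterministic sw sw′ (cong₂ _∷_ (Fin.toℕ-injective (trans x≡c (sym x′≡c))) S≡) w≡
  sweep-deterministic (row {L = L} eq τ sw) (row {L = L′} eq′ τ′ sw′) S≡ w≡
    with R≡ , S≡ , w≡ ← sameRow L L′ τ τ′ S≡ w≡ =
    cong₂ _∷_ (elements-injective (trans eq (trans R≡ (sym eq′)))) (sweep-deterministic sw sw′ S≡ w≡)
  sweep-deterministic (last eq) (last eq′) S≡ _ =
    cong (_∷ []) (elements-injective (trans eq (trans S≡ (sym eq′))))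

  -- For the case of an empty queue: `ν` has left height `h` for good, so `w` must go north before
  -- its next E or D step, and the one column left on the stack is not popped.
  segments-high : ∀ h ν {l r X} → l ≤ h → ¬ Pointwise _⊑_ (segments (suc h) ν) ((l , r) ∷ X)
  segments-high h (N ∷ ν) l≤h pw            = segments-high (suc h) ν (ℕ.m≤n⇒m≤1+n l≤h) pw
  segments-high h (E ∷ ν) l≤h ((h<l , _) ∷ _) = ℕ.<⇒≱ h<l l≤h
  segments-high h (D ∷ ν) l≤h ((h<l , _) ∷ _) = ℕ.<⇒≱ h<l l≤h

  -- The shape that `row` demands of stack and word, together with what is required to continue
  -- above that row.
  data FirstRow (h k : ℕ) (ν : List Step) : List (Fin n) → List Step → Set where
    firstRow : ∀ L {m s S S′ w} → Turn m s S S′ →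
      ∀ Q → length S′ ≡ suc (length Q) → Low (suc h) Q →
      Pointwise _⊑_ (Q ++ segments (suc h) ν) (segments (suc h) w) → norths w ≡ k →
      FirstRow h k ν (L ++ m ∷ S) (replicate (length L) E ++ s ∷ w)

  -- The word is cut after its first N or D, which exists because `norths w` is positive. Each E or
  -- D removes one column and one queued segment, so the stack stays longer by one.
  readRow : ∀ {h k ν} S Q w → length S ≡ suc (length Q) → Low h Q → norths w ≡ suc k →
    Pointwise _⊑_ (Q ++ segments (suc h) ν) (segments h w) → FirstRow h k ν S w
  readRow (m ∷ S)     Q       (N ∷ w) len low      nor pw =
    firstRow [] keep Q len (low-suc low) pw (ℕ.suc-injective nor)
  readRow {h} {ν = ν} (m ∷ S) [] (E ∷ w) len low   nor pw = ⊥-elim (segments-high h ν ℕ.≤-refl pw)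
  readRow {h} {ν = ν} (m ∷ S) [] (D ∷ w) len low   nor pw = ⊥-elim (segments-high h ν ℕ.≤-refl pw)
  readRow (m ∷ z ∷ S) (q ∷ Q) (D ∷ w) len (_ ∷ ls) nor (_ ∷ pw) =
    firstRow [] drop Q (ℕ.suc-injective len) (low-suc ls) pw (ℕ.suc-injective nor)
  readRow {ν = ν} (m ∷ S) (q ∷ Q) (E ∷ w) len (_ ∷ ls) nor (_ ∷ pw)
    with readRow {ν = ν} S Q w (ℕ.suc-injective len) ls nor pw
  ... | firstRow L τ Q′ len′ low′ pw′ nor′ = firstRow (m ∷ L) τ Q′ len′ low′ pw′ nor′

  data LastRow : List (Fin n) → List Step → Set where
    lastRow : ∀ L {m} → LastRow (L ++ [ m ]) (replicate (length L) E)

  -- Only E steps remain, one per queued segment. That is one fewer than the stack has columns, as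
  -- the root contributes no letter.
  readLastRow : ∀ {h} S Q w → length S ≡ suc (length Q) → norths w ≡ 0 →
    Pointwise _⊑_ (Q ++ []) (segments h w) → LastRow S w
  readLastRow (m ∷ [])    []      []      _   _   _ = lastRow []
  readLastRow (m ∷ [])    []      (E ∷ w) _   _   ()
  readLastRow (m ∷ z ∷ S) (q ∷ Q) (E ∷ w) len nor (_ ∷ pw)
    with readLastRow (z ∷ S) Q w (ℕ.suc-injective len) nor pw
  ... | r = consRow m r
    where
    consRow : ∀ {S w} m → LastRow S w → LastRow (m ∷ S) (E ∷ w)
    consRow m (lastRow L) = lastRow (m ∷ L)

-- This gives surjectivity of `φ`: with the queue of `sweep⇒above`, each row is read off the word as
-- a prefix of the stack, then realised by `elements-surjective`.
above⇒sweep : ∀ {n h c S w} ν → All (_≢ D) ν → Stack {n} c S → c + easts ν ≡ suc n →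
  norths w ≡ norths ν →
  ∀ Q → length S ≡ suc (length Q) → Low h Q → Pointwise _⊑_ (Q ++ segments h ν) (segments h w) →
  ∃ λ (T : Vec (Subset (suc n)) (suc (norths ν))) → Sweep T c S ν w
above⇒sweep {h = h} {c} (E ∷ ν) (_ ∷ noD) σ width nor Q len low pw
  with x , x≡c ← newColumn c (easts ν) width
  with T , sw ← above⇒sweep ν noD (push-stack x≡c σ) (trans (sym (ℕ.+-suc c _)) width) nor
         (Q ++ [ h , h ]) (cong suc (trans len (sym (length-∷ʳ Q))))
         (All.++⁺ low ((ℕ.≤-refl , ℕ.≤-refl) ∷ []))
         (subst (λ X → Pointwise _⊑_ X _) (sym (List.++-assoc Q [ h , h ] (segments h ν))) pw)
  = T , push x≡c sw
above⇒sweep (D ∷ ν) (D≢D ∷ _) _ _ _ _ _ _ _ = ⊥-elim (D≢D refl)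
above⇒sweep {S = S} {w} [] _ σ width nor Q len low pw with readLastRow S Q w len nor pw
... | lastRow L with t , eq ← elements-surjective _ (Stack.falling σ) = t ∷ [] , last eq
above⇒sweep {S = S} {w} (N ∷ ν) (_ ∷ noD) σ width nor Q len low pw
  with readRow {ν = ν} S Q w len low nor pw
... | firstRow L {m} τ Q′ len′ low′ pw′ nor′
  with t , eq ← elements-surjective (L ++ [ m ])
         (falling-++ˡ (L ++ [ m ]) (subst Falling (sym (List.++-assoc L [ m ] _)) (Stack.falling σ)))
  with T , sw ← above⇒sweep ν noD (turn-stack L τ σ) width nor′ Q′ len′ low′ pw′
  = t ∷ T , row eq τ sw

-- The word of a sweep is the word read by `φ`

filter-map-× : ∀ {A B : Set} {P Q : B → Set} (P? : Decidable P) (Q? : Decidable Q) (f : A → B) xs →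
  filter (λ y → P? y ×-dec Q? y) (map f xs) ≡ map f (filter (Q? ∘ f) (filter (P? ∘ f) xs))
filter-map-× P? Q? f []       = refl
filter-map-× P? Q? f (x ∷ xs) with P? (f x)
... | no _ = filter-map-× P? Q? f xs
... | yes _ with Q? (f x)
...   | no _  = filter-map-× P? Q? f xs
...   | yes _ = cong (f x ∷_) (filter-map-× P? Q? f xs)

map-constant : ∀ {A B : Set} {f : A → B} {y} L → (∀ {x} → x ∈ˡ L → f x ≡ y) →
  map f L ≡ replicate (length L) y
map-constant []      _  = refl
map-constant (x ∷ L) eq = cong₂ _∷_ (eq (here refl)) (map-constant L (eq ∘ there))

module _ {b a : ℕ} (T₀ : PointSet b a) where

  HasAbove HasLeft : GridPoint b a → Set
  HasAbove (x , y) = ∃ λ y′ → y Fin.< y′ × (x , y′) ∈ T₀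
  HasLeft  (x , y) = ∃ λ x′ → x′ Fin.< x × (x′ , y) ∈ T₀

  label-N : ∀ {p} → HasAbove p → label T₀ p ≡ N
  label-N {p} above =
    cong (if_then N else (if does (pointLeft? T₀ p) then E else D)) (dec-true (pointAbove? T₀ p) above)

  label-E : ∀ {p} → ¬ HasAbove p → HasLeft p → label T₀ p ≡ E
  label-E {p} ¬above left = trans
    (cong (if_then N else (if does (pointLeft? T₀ p) then E else D)) (dec-false (pointAbove? T₀ p) ¬above))
    (cong (if_then E else D) (dec-true (pointLeft? T₀ p) left))

  label-D : ∀ {p} → ¬ HasAbove p → ¬ HasLeft p → label T₀ p ≡ D
  label-D {p} ¬above ¬left = trans
    (cong (if_then N else (if does (pointLeft? T₀ p) then E else D)) (dec-false (pointAbove? T₀ p) ¬above))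
    (cong (if_then E else D) (dec-false (pointLeft? T₀ p) ¬left))

  -- On the list of all rows this is `φ T₀`; an arbitrary list of rows permits induction.
  readRows : List (Fin (suc a)) → List Step
  readRows ys = map (label T₀) (filter (λ p → (p ∈? T₀) ×-dec ¬? (p ≟ root))
    (cartesianProductWith (λ y x → x , y) ys (reverse (allFin (suc b)))))

  rowWord : Fin (suc a) → List (Fin (suc b)) → List Step
  rowWord y R = map (λ x → label T₀ (x , y)) (filter (λ x → ¬? ((x , y) ≟ root)) R)

  readRows-∷ : ∀ y ys → readRows (y ∷ ys) ≡ rowWord y (elements (lookup T₀ y)) ++ readRows ys
  readRows-∷ y ys = begin
    readRows (y ∷ ys)
      ≡⟨ cong (map (label T₀)) (List.filter-++ P? (map (_, y) cols) _) ⟩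
    map (label T₀) (filter P? (map (_, y) cols) ++ _)
      ≡⟨ List.map-++ (label T₀) (filter P? (map (_, y) cols)) _ ⟩
    map (label T₀) (filter P? (map (_, y) cols)) ++ readRows ys
      -- Testing membership first leaves the `elements` of the row, with only the root to be
      -- excluded.
      ≡⟨ cong (λ ps → map (label T₀) ps ++ readRows ys)
           (filter-map-× (_∈? T₀) (λ p → ¬? (p ≟ root)) (_, y) cols) ⟩
    map (label T₀) (map (_, y) (filter (λ x → ¬? ((x , y) ≟ root)) (elements (lookup T₀ y)))) ++ readRows ys
      ≡⟨ cong (_++ readRows ys)
           (sym (List.map-∘ (filter (λ x → ¬? ((x , y) ≟ root)) (elements (lookup T₀ y))))) ⟩
    rowWord y (elements (lookup T₀ y)) ++ readRows ys ∎
    where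
    open ≡-Reasoning
    cols = reverse (allFin (suc b))
    P? : Decidable (λ p → p ∈ T₀ × p ≢ root)
    P? p = (p ∈? T₀) ×-dec ¬? (p ≟ root)

  -- Labels refer to the whole tree `T₀`, but a sweep sees only the remaining rows `T`. The map `g`
  -- places these as the top rows of `T₀`.
  record IsUpperPart {k} (T : Vec (Subset (suc b)) (suc k)) (g : Fin (suc k) → Fin (suc a)) : Set where
    field
      agrees : ∀ i → lookup T i ≡ lookup T₀ (g i)
      offset : ℕ
      shifts : ∀ i → toℕ (g i) ≡ offset + toℕ i
      fills  : offset + k ≡ a

  open IsUpperPart

  upperPart-tail : ∀ {k t} {T : Vec (Subset (suc b)) (suc k)} {g} →
    IsUpperPart (t ∷ T) g → IsUpperPart T (g ∘ suc)
  upperPart-tail         P .agrees i = P .agrees (suc i)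
  upperPart-tail         P .offset   = suc (P .offset)
  upperPart-tail         P .shifts i = trans (P .shifts (suc i)) (ℕ.+-suc (P .offset) (toℕ i))
  upperPart-tail {k = k} P .fills    = trans (sym (ℕ.+-suc (P .offset) k)) (P .fills)

  hasAbove⁺ : ∀ {k t x} {T : Vec (Subset (suc b)) (suc k)} {g} → IsUpperPart (t ∷ T) g →
    (∃ λ i → x ∈ˢ lookup T i) → HasAbove (x , g zero)
  hasAbove⁺ {g = g} P (i , x∈) = g (suc i) ,
    subst₂ _<_ (sym (P .shifts zero)) (sym (P .shifts (suc i))) (ℕ.+-monoʳ-< (P .offset) (s≤s z≤n)) ,
    subst (_ ∈ˢ_) (P .agrees (suc i)) x∈

  -- By `fills` the part extends to the top of `T₀`, so row `y′` of `T₀` is row `suc d` of the part.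
  hasAbove⁻ : ∀ {k x} {T : Vec (Subset (suc b)) (suc k)} {g} → IsUpperPart T g →
    HasAbove (x , g zero) → ∃ λ i → 0 < toℕ i × x ∈ˢ lookup T i
  hasAbove⁻ {k} {x} {g = g} P (y′ , y<y′ , x∈)
    with d , j+d≡y′ ← ℕ.m≤n⇒∃[o]m+o≡n
           (subst (_< toℕ y′) (trans (P .shifts zero) (ℕ.+-identityʳ _)) y<y′)
    = i , subst (0 <_) (sym i≡) (s≤s z≤n) ,
      subst (x ∈ˢ_) (sym (P .agrees i)) (subst (λ y → (x , y) ∈ T₀) (sym gi≡y′) x∈)
    where
    j = P .offset
    y′≡ : j + suc d ≡ toℕ y′
    y′≡ = trans (ℕ.+-suc j d) j+d≡y′
    d<k : suc d < suc k
    d<k = s≤s (ℕ.+-cancelˡ-≤ j _ _ (subst₂ _≤_ (sym y′≡) (sym (P .fills)) (s≤s⁻¹ (Fin.toℕ<n y′))))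
    i : Fin (suc k)
    i = fromℕ< d<k
    i≡ : toℕ i ≡ suc d
    i≡ = Fin.toℕ-fromℕ< d<k
    gi≡y′ : g i ≡ y′
    gi≡y′ = Fin.toℕ-injective (trans (P .shifts i) (trans (cong (j +_) i≡) y′≡))

  module _ {k} {T : Vec (Subset (suc b)) (suc k)} {g L m} (P : IsUpperPart T g)
           (eq : elements (lookup T zero) ≡ L ++ [ m ])
           (L-free : ∀ {x i} → x ∈ˡ L → 0 < toℕ i → ¬ x ∈ˢ lookup T i) where

    private
      rowFalling : Falling (L ++ [ m ])
      rowFalling = subst Falling eq (elements-falling (lookup T zero))

    L-nonRoot : ∀ {x} → x ∈ˡ L → (x , g zero) ≢ root
    L-nonRoot x∈L x-root with refl ← cong proj₁ x-root =
      ℕ.n≮0 (falling-++⇒> L rowFalling x∈L (here refl))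

    label-L : ∀ {x} → x ∈ˡ L → label T₀ (x , g zero) ≡ E
    label-L {x} x∈L = label-E
      (λ above → let i , 0<i , x∈ = hasAbove⁻ P above in L-free x∈L 0<i x∈)
      (m , falling-++⇒> L rowFalling x∈L (here refl) ,
       subst (m ∈ˢ_) (P .agrees zero) (∈-row⁻ eq (∈-insert L)))

    ¬hasLeft-m : ¬ HasLeft (m , g zero)
    ¬hasLeft-m (x , x<m , x∈) =
      ℕ.<⇒≱ x<m (row-≥ L rowFalling (∈-row⁺ eq (subst (x ∈ˢ_) (sym (P .agrees zero)) x∈)))

    -- The root sits at the left end of its row and has no label, so no letter follows the E steps.
    readRow-root : (m , g zero) ≡ root → rowWord (g zero) (L ++ [ m ]) ≡ replicate (length L) E
    readRow-root m-root = begin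
      map f (filter Q? (L ++ [ m ]))        ≡⟨ cong (map f) (List.filter-++ Q? L [ m ]) ⟩
      map f (filter Q? L ++ filter Q? [ m ]) ≡⟨ cong₂ (λ A B → map f (A ++ B))
                                                 (List.filter-all Q? (All.tabulate L-nonRoot))
                                                 (List.filter-none Q? ((λ ≢root → ≢root m-root) ∷ [])) ⟩
      map f (L ++ [])                       ≡⟨ cong (map f) (List.++-identityʳ L) ⟩
      map f L                               ≡⟨ map-constant L label-L ⟩
      replicate (length L) E                ∎
      where
      open ≡-Reasoning
      f = λ x → label T₀ (x , g zero)
      Q? : Decidable (λ x → (x , g zero) ≢ root)
      Q? x = ¬? ((x , g zero) ≟ root)

    readRow-nonTop : g zero ≢ fromℕ a →
      rowWord (g zero) (L ++ [ m ]) ≡ replicate (length L) E ++ [ label T₀ (m , g zero) ]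
    readRow-nonTop nonTop = begin
      map f (filter Q? (L ++ [ m ]))        ≡⟨ cong (map f)
                                                 (List.filter-all Q? (All.tabulate (λ _ → nonTop ∘ cong proj₂))) ⟩
      map f (L ++ [ m ])                    ≡⟨ List.map-++ f L [ m ] ⟩
      map f L ++ [ f m ]                    ≡⟨ cong (_++ [ f m ]) (map-constant L label-L) ⟩
      replicate (length L) E ++ [ f m ]     ∎
      where
      open ≡-Reasoning
      f = λ x → label T₀ (x , g zero)
      Q? : Decidable (λ x → (x , g zero) ≢ root)
      Q? x = ¬? ((x , g zero) ≟ root)

  sweep⇒word : ∀ {k c S ν w} {T : Vec (Subset (suc b)) (suc k)} {g} →
    Stack c S → c + easts ν ≡ suc b →
    Sweep T c S ν w → IsUpperPart T g → readRows (tabulate g) ≡ w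
  sweep⇒word {c = c} σ width (push x≡c sw) P =
    sweep⇒word (push-stack x≡c σ) (trans (sym (ℕ.+-suc c _)) width) sw P
  sweep⇒word {c = c} {g = g} σ width (row {k} {t} {T} {L = L} {m} {s} {S} {S′} {ν} {w} eq τ sw) P = begin
    readRows (tabulate g)
      ≡⟨ readRows-∷ (g zero) (tabulate (g ∘ suc)) ⟩
    rowWord (g zero) (elements (lookup T₀ (g zero))) ++ readRows (tabulate (g ∘ suc))
      ≡⟨ cong₂ _++_ (cong (rowWord (g zero)) (trans (cong elements (sym (P .agrees zero))) eq))
                    (sweep⇒word (turn-stack L τ σ) width sw (upperPart-tail P)) ⟩
    rowWord (g zero) (L ++ [ m ]) ++ w
      ≡⟨ cong (_++ w) (readRow-nonTop P eq L-free nonTop) ⟩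
    (replicate (length L) E ++ [ label T₀ (m , g zero) ]) ++ w
      ≡⟨ List.++-assoc (replicate (length L) E) [ _ ] w ⟩
    replicate (length L) E ++ label T₀ (m , g zero) ∷ w
      ≡⟨ cong (λ s → replicate (length L) E ++ s ∷ w) (label-m τ U) ⟩
    replicate (length L) E ++ s ∷ w ∎
    where
    open ≡-Reasoning
    U : UpperRows T c S′ ν
    U = sweep⇒upperRows (turn-stack L τ σ) width sw
    -- Columns of `L` are left of `c` and strictly right of everything on `S′`, so they are no
    -- longer alive.
    L-free : ∀ {x i} → x ∈ˡ L → 0 < toℕ i → ¬ x ∈ˢ lookup (t ∷ T) i
    L-free {i = suc i} x∈L _ x∈ with UpperRows.alive U i x∈
    ... | inj₂ c≤x  = ℕ.<⇒≱ (Stack.below σ (∈-++⁺ˡ x∈L)) c≤x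
    ... | inj₁ x∈S′ = ℕ.<-irrefl refl (falling-++⇒> L (Stack.falling σ) x∈L (turn-⊆ τ x∈S′))
    -- In the top row the offset would be `a`, but `suc k` more rows lie above.
    nonTop : g zero ≢ fromℕ a
    nonTop top = ℕ.m+1+n≢m (P .offset) (begin
      P .offset + suc k ≡⟨ P .fills ⟩
      a                 ≡⟨ sym (trans (cong toℕ top) (Fin.toℕ-fromℕ a)) ⟩
      toℕ (g zero)      ≡⟨ trans (P .shifts zero) (ℕ.+-identityʳ _) ⟩
      P .offset         ∎)
    label-m : ∀ {s S′} → Turn m s S S′ → UpperRows T c S′ ν → label T₀ (m , g zero) ≡ s
    label-m keep U = label-N (hasAbove⁺ P (UpperRows.columns U (inj₁ (here refl))))
    label-m drop U = label-D
      (λ above → let i , 0<i , m∈ = hasAbove⁻ P above in ¬above i 0<i m∈)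
      (¬hasLeft-m P eq L-free)
      where
      ¬above : ∀ i → 0 < toℕ i → ¬ m ∈ˢ lookup (t ∷ T) i
      ¬above (suc i) _ m∈ = alive-unique L σ (∈-insert L) (UpperRows.alive U i m∈)
  sweep⇒word {c = c} {g = g} σ width (last {t} {L = L} {m} eq) P = begin
    readRows (g zero ∷ [])
      ≡⟨ readRows-∷ (g zero) [] ⟩
    rowWord (g zero) (elements (lookup T₀ (g zero))) ++ []
      ≡⟨ List.++-identityʳ _ ⟩
    rowWord (g zero) (elements (lookup T₀ (g zero)))
      ≡⟨ cong (rowWord (g zero)) (trans (cong elements (sym (P .agrees zero))) eq) ⟩
    rowWord (g zero) (L ++ [ m ])
      ≡⟨ readRow-root P eq (λ { {i = zero} _ () }) (cong₂ _,_ m≡0 top) ⟩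
    replicate (length L) E ∎
    where
    open ≡-Reasoning
    top : g zero ≡ fromℕ a
    top = Fin.toℕ-injective (trans (P .shifts zero) (trans (P .fills) (sym (Fin.toℕ-fromℕ a))))
    m≡0 : m ≡ zero
    -- Removing `L` leaves `m` as the only column, so it is the base.
    m≡0 with here 0≡m ← Stack.base (drop-stack L σ) = sym 0≡m

-- Initial state of the sweep, and the bijection

module _ {b a : ℕ} (ν : LatticePath b a) where

  private
    w₀ = proj₁ ν
    noD = proj₁ (proj₂ ν)
    ends = proj₂ (proj₂ ν)

  ∈R⇒reach : ∀ {x y} → (x , y) ∈R ν → toℕ x < reach 1 w₀ (toℕ y)
  ∈R⇒reach (h , v , h≤y) = vertices⇒reach 0 0 w₀ v h≤y

  reach⇒∈R : ∀ {x y} → toℕ x < reach 1 w₀ (toℕ y) → (x , y) ∈R ν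
  reach⇒∈R {x} {y} = reach⇒vertices 0 0 w₀ (toℕ y) z≤n

  initialStack : Stack {b} 1 [ zero ]
  initialStack = record
    { falling = [] ∷ []
    ; below   = λ { (here refl) → s≤s z≤n }
    ; base    = here refl
    }

  initialAlive : (x : Fin (suc b)) → Alive 1 [ zero ] x
  initialAlive zero    = inj₁ (here refl)
  initialAlive (suc x) = inj₂ (s≤s z≤n)

  width : 1 + easts w₀ ≡ suc b
  width = cong suc (endsAt⇒easts w₀ ends)

  tree⇒upperRows : ∀ {T} → IsSchröderTree ν T → UpperRows T 1 [ zero ] w₀
  tree⇒upperRows t = record
    { height     = endsAt⇒norths w₀ ends
    ; alive      = λ _ _ → initialAlive _
    ; inReach    = λ _ x∈ → ∈R⇒reach (t .inRegion x∈)
    -- Rows of the region only get longer upwards, so a rectangle lies in the region as soon as its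
    -- southeast corner does.
    ; compatible = λ y y′ x∈ x′∈ y<y′ x<x′ x′<reach →
        t .compatible x∈ x′∈ (inj₁ ((x<x′ , y<y′) , λ (u , v) ((_ , u≤x′) , (y≤v , _)) →
          reach⇒∈R (ℕ.<-≤-trans (ℕ.≤-<-trans u≤x′ x′<reach) (reach-mono 1 w₀ y≤v))))
    ; hasRoot    = t .hasRoot
    ; rows       = t .rows
    ; columns    = λ {x} _ → t .columns x
    }
    where open IsSchröderTree

  upperRows⇒tree : ∀ {T} → UpperRows T 1 [ zero ] w₀ → IsSchröderTree ν T
  upperRows⇒tree {T} U = record
    { inRegion   = λ {(x , y)} x∈ → reach⇒∈R (U .inReach y x∈)
    ; compatible = λ { p∈ q∈ (inj₁ i) → comp p∈ q∈ i ; p∈ q∈ (inj₂ i) → comp q∈ p∈ i }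
    ; hasRoot    = U .hasRoot
    ; rows       = U .rows
    ; columns    = λ x → U .columns (initialAlive x)
    }
    where
    open UpperRows
    comp : ∀ {p q} → p ∈ T → q ∈ T → ¬ (p ≪ q × (∀ r → InRectangle p q r → r ∈R ν))
    comp {x , y} {x′ , y′} p∈ q∈ ((x<x′ , y<y′) , rect) =
      U .compatible y y′ p∈ q∈ y<y′ x<x′
        (∈R⇒reach (rect (x′ , y) ((ℕ.<⇒≤ x<x′ , ℕ.≤-refl) , (ℕ.≤-refl , ℕ.<⇒≤ y<y′))))

  SweepFrom : PointSet b a → List Step → Set
  SweepFrom T w = Sweep T 1 [ zero ] w₀ w

  sweep⇒φ : ∀ {T w} → SweepFrom T w → φ T ≡ w
  sweep⇒φ {T} sw = sweep⇒word T initialStack width sw (record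
    { agrees = λ _ → refl
    ; offset = 0
    ; shifts = λ _ → refl
    ; fills  = refl
    })

  tree⇒sweep : ∀ {T} → IsSchröderTree ν T → SweepFrom T (φ T)
  tree⇒sweep {T} t with w , sw ← upperRows⇒sweep T noD initialStack width (tree⇒upperRows t) =
    subst (SweepFrom T) (sym (sweep⇒φ sw)) sw

  sweep⇒tree : ∀ {T w} → SweepFrom T w → IsSchröderTree ν T
  sweep⇒tree sw = upperRows⇒tree (sweep⇒upperRows initialStack width sw)

  sweep⇒path : ∀ {T w} → SweepFrom T w → IsSchröderPath ν w
  sweep⇒path {w = w} sw = trans (foldl-move 0 0 w) (cong₂ _,_ easts≡b (sweep⇒norths sw)) , above
    where
    above : StaysAbove w₀ w
    above = sweep⇒above sw [] refl []
    -- `StaysAbove` pairs the segments of both paths, so `w` has as many as `ν`.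
    easts≡b : easts w ≡ b
    easts≡b = trans (sym (length-segments 0 w)) (trans (sym (Pointwise-length above))
      (trans (length-segments 0 w₀) (endsAt⇒easts w₀ ends)))

  path⇒sweep : ∀ {w} → IsSchröderPath ν w → ∃ λ T → SweepFrom T w
  path⇒sweep {w} (ends′ , above) =
    subst (λ k → ∃ λ (T : Vec (Subset (suc b)) (suc k)) → Sweep T 1 [ zero ] w₀ w)
    (endsAt⇒norths w₀ ends)
    (above⇒sweep w₀ noD initialStack width
      (trans (endsAt⇒norths w ends′) (sym (endsAt⇒norths w₀ ends))) [] refl [] above)

theorem3p11 : (b a : ℕ) (ν : LatticePath b a) →
    Σ (∀ T → IsSchröderTree ν T → IsSchröderPath ν (φ T)) λ φ-path →
    Bijective (_≈ᵀ_ {ν = ν}) (_≈ᴾ_ {ν = ν}) (restrictφ ν φ-path)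
theorem3p11 b a ν =
  (λ T t → sweep⇒path ν (tree⇒sweep ν t)) ,
  (λ {(T , t)} {(T′ , t′)} φT≡φT′ →
    sweep-deterministic (tree⇒sweep ν t) (tree⇒sweep ν t′) refl φT≡φT′) ,
  -- Surjectivity asks for the value at every tree with the same point set as `T`; matching on
  -- `refl` reduces this to `T`.
  λ (w , path) → let T , sw = path⇒sweep ν path in
    (T , sweep⇒tree ν sw) , λ { {T′ , _} refl → sweep⇒φ ν sw }
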